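{- Let $m \geq 5$ be an integer. Then the helm graph $H_m$ satisfies $\mathrm{Z}(H_m) = \left\lceil \frac{m}{2} \right\rceil$ and $$\mathrm{pt}(H_m) \leq \begin{cases} 6 & \text{if } m \equiv 0 \pmod 4,\\ 4 & \text{if } m \equiv 1 \pmod 4,\\ 5 & \text{if } m \equiv 2 \pmod 4 \text{ or } m \equiv 3 \pmod 4. \end{cases}$$
   Context: The helm graph $H_m$ is the (simple, undirected) graph with vertex set $\{v_0,v_1,\dots,v_m\} \cup \{p_1,\dots,p_m\}$ whose edges are: $v_0v_i$ for $1\le i\le m$; $v_iv_{i+1}$ for $1 \le i \le m-1$; $v_1v_m$; and $v_ip_i$ for $1\le i\le m$. That is, it is the wheel with center $v_0$ and $m$ spoke vertices, with one pendant vertex attached to each spoke vertex. Zero forcing: each vertex of a graph $G$ is initially colored blue or white. Color change rule: if $u$ is blue and $v$ is the only white neighbor of $u$, then $u$ can force $v$ to become blue; blue vertices stay blue. A set $B \subseteq V(G)$ is a zero forcing set of $G$ if, starting with exactly the vertices of $B$ blue, repeated application of the rule eventually makes every vertex blue. The zero forcing number $\mathrm{Z}(G)$ is the minimum cardinality of a zero forcing set of $G$. Propagation time: for a zero forcing set $B$ let $B^{[0]} = B$ and, for $k \geq 1$, let $B^{[k]} = B^{[k-1]} \cup B^{(k)}$, where $B^{(k)}$ is the set of all white vertices that can be forced by the color change rule when $B^{[k-1]}$ is exactly the set of blue vertices (all possible forces are performed simultaneously in each time-step). Then $\mathrm{pt}(G,B)$ is the least $k$ with $B^{[k]} = V(G)$,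 and $\mathrm{pt}(G) = \min\{\mathrm{pt}(G,B) : B \text{ is a zero forcing set of } G \text{ with } |B| = \mathrm{Z}(G)\}$. -}

module Defs where

open import Data.Fin.Base using (Fin; zero; suc; toℕ; splitAt)
import Data.Fin.Properties as Fin
open import Data.Fin.Subset using (Subset; _∈_; _∪_; ⁅_⁆; ⊤; ∣_∣)
open import Data.Nat.Base using (ℕ; zero; suc; _+_; _≤_)
import Data.Nat.Properties as ℕ
open import Data.Product.Base using (∃-syntax; _×_; _,_)
open import Data.Sum.Base using (_⊎_; inj₁; inj₂; [_,_]′)
open import Function.Base using (_on_)
open import Level using (0ℓ)
open import Relation.Binary.Core using (Rel)
open import Relation.Binary.Construct.Closure.ReflexiveTransitive using (Star)
open import Relation.Binary.Construct.Closure.Symmetric using (SymClosure; fwd; bwd; symmetric)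
open import Relation.Binary.Definitions using (Decidable; Irreflexive; Symmetric)
open import Relation.Binary.PropositionalEquality using (_≡_; _≢_; refl)
open import Relation.Nullary.Decidable using (yes; no; map′; ¬?; _×-dec_; _⊎-dec_)
open import Relation.Nullary.Negation using (¬_)
open import Relation.Unary using (Pred)

-- Finite simple undirected graphs.  Adjacency is decidable, so that the
-- constructive reading of the notions below agrees with the classical one.
record Graph : Set₁ where
  field
    order    : ℕ
    _~_      : Rel (Fin order) 0ℓ
    _~?_     : Decidable _~_
    ~-sym    : Symmetric _~_
    ~-irrefl : Irreflexive _≡_ _~_

  Vertex : Set
  Vertex = Fin order

IsLeast : Pred ℕ 0ℓ → Pred ℕ 0ℓ
IsLeast P k = P k × (∀ j → P j → k ≤ j)

module _ (G : Graph) where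
  open Graph G

  -- u can force v when exactly the vertices satisfying Blue are blue.
  CanForce : Pred Vertex 0ℓ → Rel Vertex 0ℓ
  CanForce Blue u v =
    Blue u × u ~ v × ¬ Blue v × (∀ w → u ~ w → ¬ Blue w → w ≡ v)

  data Step (S : Subset order) : Subset order → Set where
    force : ∀ {u v} → CanForce (_∈ S) u v → Step S (S ∪ ⁅ v ⁆)

  IsZeroForcingSet : Pred (Subset order) 0ℓ
  IsZeroForcingSet B = Star Step B ⊤

  -- IsZeroForcingNumber k says Z(G) = k.
  IsZeroForcingNumber : Pred ℕ 0ℓ
  IsZeroForcingNumber =
    IsLeast λ k → ∃[ B ] IsZeroForcingSet B × ∣ B ∣ ≡ k

  -- BlueAfter B k is the set B^[k]; the right summand is B^(k+1).
  BlueAfter : Subset order → ℕ → Pred Vertex 0ℓ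
  BlueAfter B zero    v = v ∈ B
  BlueAfter B (suc k) v =
    BlueAfter B k v ⊎ (∃[ u ] CanForce (BlueAfter B k) u v)

  -- IsPropagationTimeOf B k says pt(G,B) = k.
  IsPropagationTimeOf : Subset order → Pred ℕ 0ℓ
  IsPropagationTimeOf B = IsLeast λ k → ∀ v → BlueAfter B k v

  -- IsPropagationTime k says pt(G) = k.
  IsPropagationTime : Pred ℕ 0ℓ
  IsPropagationTime =
    IsLeast λ k → ∃[ B ] IsZeroForcingSet B
                       × IsZeroForcingNumber ∣ B ∣
                       × IsPropagationTimeOf B k

-- rim i and pendant i are v_{i+1} and p_{i+1}: indices start at 0.
data HelmVertex (m : ℕ) : Set where
  hub     : HelmVertex m
  rim     : Fin m → HelmVertex m
  pendant : Fin m → HelmVertex m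

-- Each edge in one orientation.  The condition i ≢ j on the edge v_1 v_m only
-- excludes the loop that would arise for m = 1.
data HelmEdge {m : ℕ} : Rel (HelmVertex m) 0ℓ where
  spoke : ∀ {i} → HelmEdge hub (rim i)
  next  : ∀ {i j} → suc (toℕ i) ≡ toℕ j → HelmEdge (rim i) (rim j)
  close : ∀ {i j} → toℕ i ≡ 0 × suc (toℕ j) ≡ m × i ≢ j → HelmEdge (rim i) (rim j)
  leaf  : ∀ {i} → HelmEdge (rim i) (pendant i)

helmEdge? : ∀ {m} → Decidable (HelmEdge {m})
helmEdge? hub         hub         = no λ ()
helmEdge? hub         (rim j)     = yes spoke
helmEdge? hub         (pendant j) = no λ ()
helmEdge? (rim i)     hub         = no λ ()
helmEdge? {m} (rim i) (rim j)     =
  map′ [ next , close ]′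
       (λ { (next e) → inj₁ e ; (close e) → inj₂ e })
       ((suc (toℕ i) ℕ.≟ toℕ j) ⊎-dec
        ((toℕ i ℕ.≟ 0) ×-dec (suc (toℕ j) ℕ.≟ m) ×-dec ¬? (i Fin.≟ j)))
helmEdge? (rim i)     (pendant j) =
  map′ (λ { refl → leaf }) (λ { leaf → refl }) (i Fin.≟ j)
helmEdge? (pendant i) _           = no λ ()

helmEdge-irrefl : ∀ {m} {x : HelmVertex m} → ¬ HelmEdge x x
helmEdge-irrefl (next e)              = ℕ.1+n≢n e
helmEdge-irrefl (close (_ , _ , i≢i)) = i≢i refl

-- A bijection from Fin (1 + (m + m)) onto the named vertices.
label : ∀ m → Fin (1 + (m + m)) → HelmVertex m
label m zero    = hub
label m (suc x) = [ rim , pendant ]′ (splitAt m x)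

helm : ℕ → Graph
helm m = record
  { order    = 1 + (m + m)
  ; _~_      = SymClosure HelmEdge on label m
  ; _~?_     = λ x y → map′ [ fwd , bwd ]′
                            (λ { (fwd e) → inj₁ e ; (bwd e) → inj₂ e })
                            (helmEdge? (label m x) (label m y) ⊎-dec
                             helmEdge? (label m y) (label m x))
  ; ~-sym    = symmetric HelmEdge
  ; ~-irrefl = λ { refl (fwd e) → helmEdge-irrefl e
                 ; refl (bwd e) → helmEdge-irrefl e }
  }

{-# OPTIONS --safe #-}

-- Lower bound: a forcing process decomposes the graph into |B| chains, and a
-- leaf is always the first or the last vertex of its chain; hence at most 2|B|
-- leaves, and m ≤ 2|B| for the helm.
--
-- Upper bound: the initial set consists of ⌈m/2⌉ pendant vertices, whose rim
-- neighbours turn blue at time 1.  Writing down the time at which each rim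
-- vertex turns blue, in cyclic order, the process is (1 1 3 3)ʲ followed by
--   1 1 3 3 1,   1 1 3 4 3 1,   1 1 3 4 1 3 1,   1 1 3 5 4 1 3 1
-- according to m mod 4 = 1, 2, 3, 0.  The hub is forced at time 2 by the first
-- rim vertex, and itself forces the 4 of the second tail and the 5 of the last.
module Submission where

open import Defs
open import Data.Nat.Base using (ℕ; _≤_; ⌈_/2⌉)
open import Data.Nat.DivMod using (_%_)
open import Data.Product.Base using (_×_; ∃-syntax)
open import Data.Sum.Base using (_⊎_)
open import Relation.Binary.PropositionalEquality using (_≡_)

open import Data.Bool.Base as Bool using (true; false; if_then_else_)
open import Data.Fin.Base using (Fin; zero; suc; toℕ; fromℕ<; _↑ˡ_; _↑ʳ_; splitAt)
import Data.Fin.Properties as Fin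
open import Data.Fin.Subset using (Subset; outside; _∈_; _∉_; _∪_; _-_; ⁅_⁆; ⊤; ⊥; ∣_∣)
open import Data.Fin.Subset.Properties
  using (_∈?_; ∈⊤; ⊆-antisym; ⊆⊤; p⊆p∪q; q⊆p∪q; x∈p∪q⁻; x∈⁅x⁆; x∈⁅y⁆⇒x≡y;
         ∣⁅x⁆∣≡1; x∈p∧x≢y⇒x∈p-y; x∈p⇒∣p-x∣<∣p∣; anySubset?)
open import Data.List.Base as List using (List; []; _∷_; allFin; length)
open import Data.List.Membership.Propositional.Properties using (∈-allFin)
open import Data.List.Relation.Unary.All as All using (All; []; _∷_)
open import Data.Nat.Base using (zero; suc; _+_; _<_; z≤n; s≤s; s<s; s≤s⁻¹; _≡ᵇ_; _<ᵇ_)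
open import Data.Nat.DivMod using ([m+n]%n≡m%n)
import Data.Nat.Properties as ℕ
open import Data.Product.Base using (_,_; proj₁; proj₂)
open import Data.Sum.Base using (inj₁; inj₂; [_,_]′)
open import Data.Vec.Base using ([]; _∷_; _++_; tabulate)
open import Data.Vec.Properties using (lookup-++ʳ; lookup∘tabulate; lookup⇒[]=)
open import Function.Base using (_∘_; case_of_)
open import Function.Definitions using (Injective)
open import Level using (0ℓ)
open import Relation.Binary.Definitions as B using ()
open import Relation.Binary.Construct.Closure.ReflexiveTransitive using (Star; ε; _◅_; _◅◅_)
open import Relation.Binary.Construct.Closure.Symmetric using (SymClosure; fwd; bwd)
open import Relation.Binary.PropositionalEquality using (_≢_; refl; sym; trans; cong; subst)
open import Relation.Nullary.Decidable using (yes; no; True; toWitness; ¬?; _×-dec_; _⊎-dec_; _→-dec_)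
open import Relation.Nullary.Negation using (¬_; contradiction)
open import Relation.Unary using (Pred; Decidable)

-- Cardinalities of finite subsets, and least witnesses.

∣p∪q∣≤∣p∣+∣q∣ : ∀ {n} (p q : Subset n) → ∣ p ∪ q ∣ ≤ ∣ p ∣ + ∣ q ∣
∣p∪q∣≤∣p∣+∣q∣ []          []          = z≤n
∣p∪q∣≤∣p∣+∣q∣ (true  ∷ p) (true  ∷ q) =
  s≤s (ℕ.≤-trans (∣p∪q∣≤∣p∣+∣q∣ p q) (ℕ.+-monoʳ-≤ ∣ p ∣ (ℕ.n≤1+n ∣ q ∣)))
∣p∪q∣≤∣p∣+∣q∣ (true  ∷ p) (false ∷ q) = s≤s (∣p∪q∣≤∣p∣+∣q∣ p q)
∣p∪q∣≤∣p∣+∣q∣ (false ∷ p) (true  ∷ q) =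
  ℕ.≤-trans (s≤s (∣p∪q∣≤∣p∣+∣q∣ p q)) (ℕ.≤-reflexive (sym (ℕ.+-suc ∣ p ∣ ∣ q ∣)))
∣p∪q∣≤∣p∣+∣q∣ (false ∷ p) (false ∷ q) = ∣p∪q∣≤∣p∣+∣q∣ p q

∣⊥++p∣≡∣p∣ : ∀ n {m} (p : Subset m) → ∣ ⊥ {n} ++ p ∣ ≡ ∣ p ∣
∣⊥++p∣≡∣p∣ zero    p = refl
∣⊥++p∣≡∣p∣ (suc n) p = ∣⊥++p∣≡∣p∣ n p

injection⇒≤∣p∣ : ∀ {m n} (f : Fin m → Fin n) → Injective _≡_ _≡_ f →
                 (p : Subset n) → (∀ i → f i ∈ p) → m ≤ ∣ p ∣
injection⇒≤∣p∣ {zero}  f f-inj p f∈p = z≤n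
injection⇒≤∣p∣ {suc m} f f-inj p f∈p = ℕ.≤-trans
  (s≤s (injection⇒≤∣p∣ (f ∘ suc) (Fin.suc-injective ∘ f-inj) (p - f zero)
    λ i → x∈p∧x≢y⇒x∈p-y (f∈p (suc i)) λ eq → case f-inj eq of λ ()))
  (x∈p⇒∣p-x∣<∣p∣ (f∈p zero))

least : {P : Pred ℕ 0ℓ} → Decidable P → ∀ n → P n → ∃[ k ] IsLeast P k
least P? n p with P? 0
least P? n       p | yes p₀ = 0 , p₀ , λ _ _ → z≤n
least P? zero    p | no ¬p₀ = contradiction p ¬p₀
least P? (suc n) p | no ¬p₀ with k , pₖ , min ← least (P? ∘ suc) n p =
  suc k , pₖ , λ { zero p₀ → contradiction p₀ ¬p₀ ; (suc j) pⱼ → s≤s (min j pⱼ) }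

-- Parallel and sequential forcing in an arbitrary graph.

module _ (G : Graph) where
  open Graph G

  canForce? : ∀ {Blue : Pred Vertex 0ℓ} → Decidable Blue → B.Decidable (CanForce G Blue)
  canForce? {Blue} Blue? u v = Blue? u ×-dec (u ~? v) ×-dec ¬? (Blue? v) ×-dec
    Fin.all? λ w → (u ~? w) →-dec (¬? (Blue? w) →-dec (w Fin.≟ v))

  blueAfter? : ∀ B k → Decidable (BlueAfter G B k)
  blueAfter? B zero    v = v ∈? B
  blueAfter? B (suc k) v =
    blueAfter? B k v ⊎-dec Fin.any? λ u → canForce? (blueAfter? B k) u v

  -- A simultaneous step is replayed as single forces, one vertex of `vs` at a time. A force
  -- available at `BlueAfter G B k` stays available from any larger blue set `R` in which its target
  -- is still white, since enlarging the blue set only removes white neighbours.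
  sweep : ∀ {B S k} → Star (Step G) B S → (∀ v → BlueAfter G B k v → v ∈ S) →
          (vs : List Vertex) →
          ∃[ S′ ] Star (Step G) B S′ × (∀ v → BlueAfter G B k v → v ∈ S′) ×
                  All (λ v → BlueAfter G B (suc k) v → v ∈ S′) vs
  sweep {S = S} B⟶S blue []       = S , B⟶S , blue , []
  sweep {B} {k = k} B⟶S blue (v ∷ vs) with sweep B⟶S blue vs | blueAfter? B (suc k) v
  ... | R , B⟶R , blueᴿ , all | no ¬b       = R , B⟶R , blueᴿ , (λ b → contradiction b ¬b) ∷ all
  ... | R , B⟶R , blueᴿ , all | yes (inj₁ b) = R , B⟶R , blueᴿ , (λ _ → blueᴿ v b) ∷ all
  ... | R , B⟶R , blueᴿ , all | yes (inj₂ (u , bu , u~v , _ , only)) with v ∈? R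
  ...   | yes v∈R = R , B⟶R , blueᴿ , (λ _ → v∈R) ∷ all
  ...   | no  v∉R =
    R ∪ ⁅ v ⁆ ,
    B⟶R ◅◅ (force (blueᴿ u bu , u~v , v∉R ,
                   λ w u~w w∉R → only w u~w (w∉R ∘ blueᴿ w)) ◅ ε) ,
    (λ w b → p⊆p∪q _ (blueᴿ w b)) ,
    (λ _ → q⊆p∪q R _ (x∈⁅x⁆ v)) ∷ All.map (λ f b → p⊆p∪q _ (f b)) all

  reach : ∀ B k → ∃[ S ] Star (Step G) B S × (∀ v → BlueAfter G B k v → v ∈ S)
  reach B zero = B , ε , λ _ b → b
  reach B (suc k) with S , B⟶S , blue ← reach B k
                  with S′ , B⟶S′ , _ , all ← sweep B⟶S blue (allFin order) =
    S′ , B⟶S′ , λ v → All.lookup all (∈-allFin v)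

  allBlue⇒isZeroForcingSet : ∀ {B k} → (∀ v → BlueAfter G B k v) → IsZeroForcingSet G B
  allBlue⇒isZeroForcingSet {B} {k} allBlue with S , B⟶S , blue ← reach B k =
    subst (Star (Step G) B) (⊆-antisym ⊆⊤ λ {v} _ → blue v (allBlue v)) B⟶S

  blueAfter-mono : ∀ {B j k v} → j ≤ k → BlueAfter G B j v → BlueAfter G B k v
  blueAfter-mono {k = zero}  z≤n b = b
  blueAfter-mono {k = suc k} j≤1+k b with ℕ.m≤n⇒m<n∨m≡n j≤1+k
  ... | inj₁ j<1+k = inj₁ (blueAfter-mono (s≤s⁻¹ j<1+k) b)
  ... | inj₂ refl  = b

  -- Schedules as upper bounds for forcing times.

  ForcedInTime : (Vertex → ℕ) → Pred Vertex 0ℓ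
  ForcedInTime t v =
    ∃[ u ] u ~ v × t u < t v × (∀ w → u ~ w → w ≢ v → t w < t v)

  -- `t v` bounds the time of `v` only from above, so `v` may already be blue at step `k`. Otherwise
  -- `u` and all its neighbours except `v` are blue by induction, and `u` forces `v`.
  schedule⇒blueAfter : ∀ {B} (t : Vertex → ℕ) → (∀ v → v ∈ B ⊎ ForcedInTime t v) →
                       ∀ k v → t v ≤ k → BlueAfter G B k v
  schedule⇒blueAfter t sched k v tv≤k with sched v
  ... | inj₁ v∈B = blueAfter-mono z≤n v∈B
  schedule⇒blueAfter t sched zero v tv≤0 | inj₂ (_ , _ , tu<tv , _) =
    contradiction (ℕ.<-≤-trans tu<tv tv≤0) λ ()
  schedule⇒blueAfter {B} t sched (suc k) v tv≤1+k | inj₂ (u , u~v , tu<tv , others)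
    with blueAfter? B k v
  ... | yes b = inj₁ b
  ... | no ¬b = inj₂ (u , ih u tu<tv , u~v , ¬b , only)
    where
    ih : ∀ w → t w < t v → BlueAfter G B k w
    ih w tw<tv = schedule⇒blueAfter t sched k w (s≤s⁻¹ (ℕ.<-≤-trans tw<tv tv≤1+k))
    only : ∀ w → u ~ w → ¬ BlueAfter G B k w → w ≡ v
    only w u~w ¬bw with w Fin.≟ v
    ... | yes w≡v = w≡v
    ... | no  w≢v = contradiction (ih w (others w u~w w≢v)) ¬bw

  -- Existence of the propagation time.

  module _ {c : ℕ} (c-is-Z : IsZeroForcingNumber G c) where

    -- Minimising over `B` and `k` at once: the search runs over finitely many sets of size `c`, so
    -- it is decidable, and the least `k` found is the propagation time.
    CompleteBy : Pred ℕ 0ℓ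
    CompleteBy k = ∃[ B ] ∣ B ∣ ≡ c × (∀ v → BlueAfter G B k v)

    completeBy? : Decidable CompleteBy
    completeBy? k = anySubset? λ B → (∣ B ∣ ℕ.≟ c) ×-dec Fin.all? (blueAfter? B k)

    propagationTime : ∀ {k} → CompleteBy k → ∃[ p ] IsPropagationTime G p × p ≤ k
    propagationTime {k} complete
      with p , (B , ∣B∣≡c , allBlue) , min ← least completeBy? k complete =
      p ,
      ((B , allBlue⇒isZeroForcingSet allBlue ,
        subst (IsZeroForcingNumber G) (sym ∣B∣≡c) c-is-Z ,
        allBlue , λ j blue → min j (B , ∣B∣≡c , blue)) ,
       -- A competing `B′` is itself of minimum size, hence of size `c`, so the minimality of `p`
       -- applies to it.
       λ { j (B′ , _ , ∣B′∣-is-Z , blue , _) →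
           min j (B′ , ℕ.≤-antisym (proj₂ ∣B′∣-is-Z c (proj₁ c-is-Z))
                                   (proj₂ c-is-Z ∣ B′ ∣ (proj₁ ∣B′∣-is-Z)) , blue) }) ,
      min k complete

  -- Forcing chains and a bound on the number of leaves.

  module _ {m : ℕ} (leafᵥ support : Fin m → Vertex) (leafᵥ-inj : Injective _≡_ _≡_ leafᵥ)
           (onlySupport : ∀ i w → leafᵥ i ~ w → w ≡ support i) where

    -- T plays the role of the set of current ends of the forcing chains.
    record ChainEnds (B S T : Subset order) : Set where
      field
        size   : ∣ T ∣ ≤ ∣ B ∣
        active : ∀ {u w} → u ∈ S → u ~ w → w ∉ S → u ∈ T
        leaves : ∀ i → leafᵥ i ∈ S → leafᵥ i ∈ B ⊎ (leafᵥ i ∈ T × support i ∈ S)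

    open ChainEnds

    -- When `u` forces `v`, the end `u` gives way to `v`. Afterwards `u` has no white neighbour, so
    -- `active` survives its removal. A newly blue leaf was forced by its support; with the support
    -- blue it can never force, so it stays an end.
    advance : ∀ {B S S′ T} → ChainEnds B S T → Step G S S′ → ∃[ T′ ] ChainEnds B S′ T′
    advance {B} {S} {_} {T} ends (force {u} {v} (u∈S , u~v , v∉S , only)) =
      (T - u) ∪ ⁅ v ⁆ , record { size = size′ ; active = active′ ; leaves = leaves′ }
      where
      size′ : ∣ (T - u) ∪ ⁅ v ⁆ ∣ ≤ ∣ B ∣
      size′ = begin
        ∣ (T - u) ∪ ⁅ v ⁆ ∣      ≤⟨ ∣p∪q∣≤∣p∣+∣q∣ (T - u) ⁅ v ⁆ ⟩
        ∣ T - u ∣ + ∣ ⁅ v ⁆ ∣    ≡⟨ cong (∣ T - u ∣ +_) (∣⁅x⁆∣≡1 v) ⟩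
        ∣ T - u ∣ + 1            ≡⟨ ℕ.+-comm ∣ T - u ∣ 1 ⟩
        suc ∣ T - u ∣            ≤⟨ x∈p⇒∣p-x∣<∣p∣ (active ends u∈S u~v v∉S) ⟩
        ∣ T ∣                    ≤⟨ size ends ⟩
        ∣ B ∣                    ∎
        where open ℕ.≤-Reasoning
      active′ : ∀ {a w} → a ∈ S ∪ ⁅ v ⁆ → a ~ w → w ∉ S ∪ ⁅ v ⁆ → a ∈ (T - u) ∪ ⁅ v ⁆
      active′ a∈ a~w w∉ with x∈p∪q⁻ S ⁅ v ⁆ a∈
      ... | inj₂ a∈v = q⊆p∪q (T - u) _ a∈v
      ... | inj₁ a∈S = p⊆p∪q _ (x∈p∧x≢y⇒x∈p-y (active ends a∈S a~w w∉S) λ { refl →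
              w∉ (q⊆p∪q S _ (subst (_∈ ⁅ v ⁆) (sym (only _ a~w w∉S)) (x∈⁅x⁆ v))) })
        where w∉S = w∉ ∘ p⊆p∪q _
      leaves′ : ∀ i → leafᵥ i ∈ S ∪ ⁅ v ⁆ → leafᵥ i ∈ B ⊎
                      (leafᵥ i ∈ (T - u) ∪ ⁅ v ⁆ × support i ∈ S ∪ ⁅ v ⁆)
      leaves′ i i∈ with x∈p∪q⁻ S ⁅ v ⁆ i∈
      ... | inj₂ i∈v = inj₂ (q⊆p∪q (T - u) _ i∈v , p⊆p∪q _ (subst (_∈ S) u≡support u∈S))
        where
        u≡support : u ≡ support i
        u≡support = onlySupport i u
          (~-sym (subst (u ~_) (sym (x∈⁅y⁆⇒x≡y v i∈v)) u~v))
      ... | inj₁ i∈S with leaves ends i i∈S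
      ...   | inj₁ i∈B = inj₁ i∈B
      ...   | inj₂ (i∈T , s∈S) = inj₂ (p⊆p∪q _ (x∈p∧x≢y⇒x∈p-y i∈T i≢u) , p⊆p∪q _ s∈S)
        where
        i≢u : leafᵥ i ≢ u
        i≢u refl = v∉S (subst (_∈ S) (sym (onlySupport i v u~v)) s∈S)

    advance* : ∀ {B S S′ T} → ChainEnds B S T → Star (Step G) S S′ → ∃[ T′ ] ChainEnds B S′ T′
    advance* ends ε       = _ , ends
    advance* ends (s ◅ r) = advance* (proj₂ (advance ends s)) r

    -- The chains start with `T = B`. Once everything is blue, each leaf lies in `B` or among the
    -- final ends, of which there are at most `∣ B ∣`.
    leaves≤2∣B∣ : ∀ B → IsZeroForcingSet G B → m ≤ ∣ B ∣ + ∣ B ∣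
    leaves≤2∣B∣ B B⟶⊤
      with T , ends ← advance* {T = B} (record { size = ℕ.≤-refl ; active = λ u∈B _ _ → u∈B
                                               ; leaves = λ _ → inj₁ }) B⟶⊤ = begin
      m              ≤⟨ injection⇒≤∣p∣ leafᵥ leafᵥ-inj (B ∪ T) (λ i →
                          [ p⊆p∪q T , q⊆p∪q B T ∘ proj₁ ]′ (leaves ends i ∈⊤)) ⟩
      ∣ B ∪ T ∣      ≤⟨ ∣p∪q∣≤∣p∣+∣q∣ B T ⟩
      ∣ B ∣ + ∣ T ∣  ≤⟨ ℕ.+-monoʳ-≤ ∣ B ∣ (size ends) ⟩
      ∣ B ∣ + ∣ B ∣  ∎
      where open ℕ.≤-Reasoning

-- The helm graph: labels and the lower bound.

module _ {m : ℕ} where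

  unlabel : HelmVertex m → Fin (1 + (m + m))
  unlabel hub         = zero
  unlabel (rim i)     = suc (i ↑ˡ m)
  unlabel (pendant i) = suc (m ↑ʳ i)

  label-unlabel : ∀ h → label m (unlabel h) ≡ h
  label-unlabel hub         = refl
  label-unlabel (rim i)     = cong [ rim , pendant ]′ (Fin.splitAt-↑ˡ m i m)
  label-unlabel (pendant i) = cong [ rim , pendant ]′ (Fin.splitAt-↑ʳ m m i)

  unlabel-label : ∀ x → unlabel (label m x) ≡ x
  unlabel-label zero    = refl
  unlabel-label (suc x) with splitAt m x in eq
  ... | inj₁ i = cong suc (Fin.splitAt⁻¹-↑ˡ eq)
  ... | inj₂ i = cong suc (Fin.splitAt⁻¹-↑ʳ eq)

  label-injective : Injective _≡_ _≡_ (label m)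
  label-injective {x} {y} eq =
    trans (sym (unlabel-label x)) (trans (cong unlabel eq) (unlabel-label y))

  Adj : HelmVertex m → HelmVertex m → Set
  Adj = SymClosure HelmEdge

  leaf-neighbour : ∀ {i h} → Adj (pendant i) h → h ≡ rim i
  leaf-neighbour (bwd leaf) = refl

  helm-lower : ∀ B → IsZeroForcingSet (helm m) B → ⌈ m /2⌉ ≤ ∣ B ∣
  helm-lower B zfs = subst (⌈ m /2⌉ ≤_) (sym (ℕ.n≡⌈n+n/2⌉ ∣ B ∣)) (ℕ.⌈n/2⌉-mono
    (leaves≤2∣B∣ (helm m) (unlabel ∘ pendant) (unlabel ∘ rim)
      (λ eq → Fin.↑ʳ-injective m _ _ (Fin.suc-injective eq)) only B zfs))
    where
    only : ∀ i w → Adj (label m (unlabel (pendant i))) (label m w) → w ≡ unlabel (rim i)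
    only i w a = trans (sym (unlabel-label w)) (cong unlabel
      (leaf-neighbour (subst (λ h → Adj h (label m w)) (label-unlabel (pendant i)) a)))

-- Rim schedules and their extension by four positions.

-- The hub turns blue at time 2, whence 2 < τ n.  The stronger 3 < τ n of byHub
-- lets the rule survive the insertion of a block 1 1 3 3.
data Rule (τ : ℕ → ℕ) (n : ℕ) : Set where
  byPendant  : τ n ≡ 1 → Rule τ n
  byPrevious : ∀ k → n ≡ 2 + k → 2 < τ n → τ (1 + k) ≡ 1 → τ k < τ n → Rule τ n
  byNext     : 2 < τ n → τ (1 + n) ≡ 1 → τ (2 + n) < τ n → Rule τ n
  byHub      : 3 < τ n → (∀ k → k ≢ n → τ k < τ n) → Rule τ n

-- τ is 1 from position m - 1 on, so that positions m and m + 1 agree with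
-- positions 0 and 1, which they stand for in byNext.
record Schedule (m T : ℕ) : Set where
  field
    τ       : ℕ → ℕ
    rule    : ∀ n → Rule τ n
    τ<T     : ∀ n → τ n < T
    3<T     : 3 < T
    τ₀      : τ 0 ≡ 1
    τ₁      : τ 1 ≡ 1
    τ-end   : ∀ n → m ≤ suc n → τ n ≡ 1
    count   : ∣ tabulate {n = m} (λ i → τ (toℕ i) ≡ᵇ 1) ∣ ≡ ⌈ m /2⌉

-- Position 2 is forced by position 1, and position 3 by the old position 0, whose other rim
-- neighbour is the old position 1; this uses `τ₀` and `τ₁`. Apart from `byHub`, the old rules look
-- only at old positions. Two of the four new positions have time 1, in step with `⌈ 4 + m /2⌉`.
extend : ∀ {m T} → 2 ≤ m → Schedule m T → Schedule (4 + m) T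
extend {m} {T} 2≤m s = record
  { τ = τ′ ; rule = rule′ ; τ<T = τ′<T ; 3<T = 3<T ; τ₀ = refl ; τ₁ = refl
  ; τ-end = τ′-end ; count = cong (2 +_) count }
  where
  open Schedule s
  τ′ : ℕ → ℕ
  τ′ 0 = 1
  τ′ 1 = 1
  τ′ 2 = 3
  τ′ 3 = 3
  τ′ (suc (suc (suc (suc n)))) = τ n
  shift : ∀ n → Rule τ n → Rule τ′ (4 + n)
  shift n (byPendant e)            = byPendant e
  shift n (byPrevious k e a b c)   = byPrevious (4 + k) (cong (4 +_) e) a b c
  shift n (byNext a b c)           = byNext a b c
  shift n (byHub a b)              = byHub a others
    where
    others : ∀ k → k ≢ 4 + n → τ′ k < τ n
    others 0 _ = ℕ.<-trans (s<s (s≤s z≤n)) a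
    others 1 _ = ℕ.<-trans (s<s (s≤s z≤n)) a
    others 2 _ = a
    others 3 _ = a
    others (suc (suc (suc (suc k)))) ne = b k (ne ∘ cong (4 +_))
  rule′ : ∀ n → Rule τ′ n
  rule′ 0 = byPendant refl
  rule′ 1 = byPendant refl
  rule′ 2 = byPrevious 0 refl ℕ.≤-refl refl (s<s (s≤s z≤n))
  rule′ 3 = byNext ℕ.≤-refl τ₀ (subst (_< 3) (sym τ₁) (s<s (s≤s z≤n)))
  rule′ (suc (suc (suc (suc n)))) = shift n (rule n)
  τ′<T : ∀ n → τ′ n < T
  τ′<T 0 = ℕ.<-trans (s<s (s≤s z≤n)) 3<T
  τ′<T 1 = ℕ.<-trans (s<s (s≤s z≤n)) 3<T
  τ′<T 2 = 3<T
  τ′<T 3 = 3<T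
  τ′<T (suc (suc (suc (suc n)))) = τ<T n
  τ′-end : ∀ n → 4 + m ≤ suc n → τ′ n ≡ 1
  τ′-end 0 _ = refl
  τ′-end 1 _ = refl
  τ′-end 2 (s≤s (s≤s (s≤s ())))
  τ′-end 3 (s≤s (s≤s (s≤s (s≤s m≤0)))) = contradiction (ℕ.≤-trans 2≤m m≤0) λ ()
  τ′-end (suc (suc (suc (suc n)))) (s≤s (s≤s (s≤s (s≤s m≤1+n)))) = τ-end n m≤1+n

-- From a rim schedule to forcing on the helm.

module _ {m T : ℕ} (s : Schedule m T) where
  open Schedule s

  rimTime : Fin m → ℕ
  rimTime i = τ (toℕ i)

  -- A pendant outside the initial set gets the final time `T`, when its rim vertex can force it
  -- because the hub and the whole rim are blue; this bound need not be sharp.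
  helmTime : HelmVertex m → ℕ
  helmTime hub         = 2
  helmTime (rim i)     = rimTime i
  helmTime (pendant i) = if rimTime i ≡ᵇ 1 then 0 else T

  initial : Subset (1 + (m + m))
  initial = outside ∷ (⊥ {m} ++ tabulate (λ i → rimTime i ≡ᵇ 1))

  ∣initial∣ : ∣ initial ∣ ≡ ⌈ m /2⌉
  ∣initial∣ = trans (∣⊥++p∣≡∣p∣ m _) count

  pendant∈initial : ∀ i → rimTime i ≡ 1 → unlabel (pendant i) ∈ initial
  pendant∈initial i e = lookup⇒[]= (unlabel (pendant i)) initial
    (trans (lookup-++ʳ (⊥ {m}) _ i) (trans (lookup∘tabulate _ i) (cong (_≡ᵇ 1) e)))

  pendantTime : ∀ i → rimTime i ≡ 1 → helmTime (pendant i) ≡ 0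
  pendantTime i e = cong (λ t → if t ≡ᵇ 1 then 0 else T) e

  HelmForced : HelmVertex m → Set
  HelmForced h =
    ∃[ g ] Adj g h × helmTime g < helmTime h ×
           (∀ w → Adj g w → w ≢ h → helmTime w < helmTime h)

  rimAt : ∀ {n} → n < m → ∃[ i ] toℕ {m} i ≡ n
  rimAt n<m = fromℕ< n<m , Fin.toℕ-fromℕ< n<m

  -- Since `rimTime g ≡ 1`, the pendant at `g` is blue from the start, and the hub has time 2; only
  -- the rim neighbours of `g` remain as a hypothesis.
  forcedByRim : ∀ {g i} → Adj (rim g) (rim i) → 2 < rimTime i → rimTime g ≡ 1 →
                (∀ j → Adj (rim g) (rim j) → j ≢ i → rimTime j < rimTime i) →
                HelmForced (rim i)
  forcedByRim {g} {i} g~i 2<τ e others =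
    rim g , g~i , subst (_< rimTime i) (sym e) 1<τ , others′
    where
    1<τ = ℕ.<-trans ℕ.≤-refl 2<τ
    others′ : ∀ w → Adj (rim g) w → w ≢ rim i → helmTime w < rimTime i
    others′ hub         _          _   = 2<τ
    others′ (rim j)     g~j        j≢i = others j g~j (j≢i ∘ cong rim)
    others′ (pendant _) (fwd leaf) _   =
      subst (_< rimTime i) (sym (pendantTime g e)) (ℕ.<-trans (s≤s z≤n) 1<τ)

  -- Each rule names the forcing vertex: the pendant, the preceding rim vertex, the following one,
  -- or the hub. For a forcing rim vertex, the check concerns its other rim neighbour, possibly
  -- across the closing edge.
  rimForced : ∀ i → HelmForced (rim i)
  rimForced i with rule (toℕ i)
  ... | byPendant e = pendant i , bwd leaf ,
    subst (_< rimTime i) (sym (pendantTime i e)) (subst (0 <_) (sym e) (s≤s z≤n)) ,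
    λ w a w≢ → contradiction (leaf-neighbour a) w≢
  ... | byHub 3<τ others = hub , fwd spoke , ℕ.<-trans ℕ.≤-refl 3<τ ,
    λ { (rim j) _ j≢i → others (toℕ j) λ e → j≢i (cong rim (Fin.toℕ-injective e))
      ; hub (fwd ()) _ ; hub (bwd ()) _ ; (pendant j) (fwd ()) _ ; (pendant j) (bwd ()) _ }
  ... | byPrevious k i≡2+k 2<τ e before
    with g , g≡1+k ← rimAt (ℕ.<-trans (ℕ.≤-reflexive (sym i≡2+k)) (Fin.toℕ<n i)) =
    forcedByRim (fwd (next (trans (cong suc g≡1+k) (sym i≡2+k))))
                2<τ (trans (cong τ g≡1+k) e) others
    where
    others : ∀ j → Adj (rim g) (rim j) → j ≢ i → rimTime j < rimTime i
    others j (fwd (next 1+g≡j)) j≢i = contradiction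
      (Fin.toℕ-injective (trans (sym 1+g≡j) (trans (cong suc g≡1+k) (sym i≡2+k)))) j≢i
    others j (bwd (next 1+j≡g)) _ =
      subst (λ n → τ n < rimTime i) (sym (ℕ.suc-injective (trans 1+j≡g g≡1+k))) before
    others j (fwd (close (g≡0 , _))) _ = contradiction (trans (sym g≡1+k) g≡0) λ ()
    others j (bwd (close (j≡0 , _))) _ =
      subst (_< rimTime i) (sym (trans (cong τ j≡0) τ₀)) (ℕ.<-trans ℕ.≤-refl 2<τ)
  ... | byNext 2<τ e after with ℕ.m≤n⇒m<n∨m≡n (Fin.toℕ<n i)
  -- The last position has time 1 by `τ-end`, so the following vertex never lies across the closing
  -- edge.
  ...   | inj₂ 1+i≡m = contradiction
    (subst (2 <_) (τ-end (toℕ i) (ℕ.≤-reflexive (sym 1+i≡m))) 2<τ) λ { (s≤s ()) }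
  ...   | inj₁ 1+i<m with g , g≡1+i ← rimAt 1+i<m =
    forcedByRim (bwd (next (sym g≡1+i))) 2<τ (trans (cong τ g≡1+i) e) others
    where
    others : ∀ j → Adj (rim g) (rim j) → j ≢ i → rimTime j < rimTime i
    others j (fwd (next 1+g≡j)) _ =
      subst (λ n → τ n < rimTime i) (trans (cong suc (sym g≡1+i)) 1+g≡j) after
    others j (bwd (next 1+j≡g)) j≢i = contradiction
      (Fin.toℕ-injective (ℕ.suc-injective (trans 1+j≡g g≡1+i))) j≢i
    others j (fwd (close (g≡0 , _))) _ = contradiction (trans (sym g≡1+i) g≡0) λ ()
    -- If `rim g` is the last rim vertex, its other rim neighbour is position 0, of time 1.
    others j (bwd (close (j≡0 , _))) _ =
      subst (_< rimTime i) (sym (trans (cong τ j≡0) τ₀)) (ℕ.<-trans ℕ.≤-refl 2<τ)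

  pendantForced : ∀ i → rimTime i ≡ 1 ⊎ HelmForced (pendant i)
  pendantForced i with rimTime i ≡ᵇ 1 in eq
  ... | true  = inj₁ (ℕ.≡ᵇ⇒≡ _ _ (subst Bool.T (sym eq) _))
  ... | false = inj₂ (rim i , fwd leaf , τ<T (toℕ i) , others)
    where
    others : ∀ w → Adj (rim i) w → w ≢ pendant i → helmTime w < T
    others hub         _           _  = ℕ.<-trans ℕ.≤-refl 3<T
    others (rim j)     _           _  = τ<T (toℕ j)
    others (pendant j) (fwd leaf)  ne = contradiction refl ne

  -- Position 0 forces the hub: its rim neighbours, positions 1 and `m - 1`, have time 1 by `τ₁` and
  -- `τ-end`, so after step 1 only the hub can still be white around it.
  hubForced : 0 < m → HelmForced hub
  hubForced 0<m with g , g≡0 ← rimAt 0<m = rim g , bwd spoke , τ≡1⇒<2 {g} (trans (cong τ g≡0) τ₀) , others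
    where
    τ≡1⇒<2 : ∀ {i} → rimTime i ≡ 1 → rimTime i < 2
    τ≡1⇒<2 e = ℕ.≤-reflexive (cong suc e)
    others : ∀ w → Adj (rim g) w → w ≢ hub → helmTime w < 2
    others hub _ ne = contradiction refl ne
    others _ (fwd leaf) _ =
      subst (_< 2) (sym (pendantTime g (trans (cong τ g≡0) τ₀))) (s≤s z≤n)
    others _ (fwd (next {j = j} 1+g≡j)) _ =
      τ≡1⇒<2 {j} (trans (cong τ (trans (sym 1+g≡j) (cong suc g≡0))) τ₁)
    others _ (bwd (next 1+j≡g)) _ = contradiction (trans 1+j≡g g≡0) λ ()
    others _ (fwd (close {j = j} (_ , 1+j≡m , _))) _ =
      τ≡1⇒<2 {j} (τ-end (toℕ j) (ℕ.≤-reflexive (sym 1+j≡m)))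
    others _ (bwd (close {i = j} (j≡0 , _))) _ = τ≡1⇒<2 {j} (trans (cong τ j≡0) τ₀)

  helmSchedule : 0 < m → ∀ v → v ∈ initial ⊎ ForcedInTime (helm m) (helmTime ∘ label m) v
  helmSchedule 0<m v = subst (λ v → v ∈ initial ⊎ ForcedInTime (helm m) (helmTime ∘ label m) v)
                            (unlabel-label v) (go (label m v))
    where
    fromHelm : ∀ h → HelmForced h →
               ForcedInTime (helm m) (helmTime ∘ label m) (unlabel h)
    fromHelm h (g , a , lt , others)
      rewrite label-unlabel h = unlabel g ,
      subst (λ x → Adj x h) (sym (label-unlabel g)) a ,
      subst (λ x → helmTime x < helmTime h) (sym (label-unlabel g)) lt ,
      λ w b w≢ → others (label m w) (subst (λ x → Adj x (label m w)) (label-unlabel g) b)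
                   λ e → w≢ (trans (sym (unlabel-label w)) (cong unlabel e))
    go : ∀ h → unlabel h ∈ initial ⊎
               ForcedInTime (helm m) (helmTime ∘ label m) (unlabel h)
    go hub         = inj₂ (fromHelm hub (hubForced 0<m))
    go (rim i)     = inj₂ (fromHelm (rim i) (rimForced i))
    go (pendant i) = [ inj₁ ∘ pendant∈initial i , inj₂ ∘ fromHelm (pendant i) ]′
                       (pendantForced i)

  helmTime≤T : ∀ h → helmTime h ≤ T
  helmTime≤T hub     = ℕ.≤-trans (ℕ.n≤1+n 2) (ℕ.<⇒≤ 3<T)
  helmTime≤T (rim i) = ℕ.<⇒≤ (τ<T (toℕ i))
  helmTime≤T (pendant i) with rimTime i ≡ᵇ 1
  ... | true  = z≤n
  ... | false = ℕ.≤-refl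

  allBlue : 0 < m → ∀ v → BlueAfter (helm m) initial T v
  allBlue 0<m v = schedule⇒blueAfter (helm m) _ (helmSchedule 0<m) T v (helmTime≤T (label m v))

-- The four explicit tails.

-- The entries missing at the end read 1, as τ-end demands.
at : List ℕ → ℕ → ℕ
at []       _       = 1
at (x ∷ xs) zero    = x
at (x ∷ xs) (suc n) = at xs n

at-end : ∀ xs {n} → length xs ≤ n → at xs n ≡ 1
at-end []       _           = refl
at-end (x ∷ xs) (s≤s len≤n) = at-end xs len≤n

at-< : ∀ {xs t} → 1 < t → All (_< t) xs → ∀ n → at xs n < t
at-< 1<t []         n       = 1<t
at-< 1<t (px ∷ pxs) zero    = px
at-< 1<t (px ∷ pxs) (suc n) = at-< 1<t pxs n

-- Serves the side condition of `byHub`, where the hub forces the unique latest rim vertex; `1 < t`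
-- covers the positions past the end of the list.
at-peak : ∀ xs {ys t} → 1 < t → All (_< t) xs → All (_< t) ys →
          ∀ k → k ≢ length xs → at (xs List.++ t ∷ ys) k < t
at-peak [] 1<t []         pys zero    k≢0 = contradiction refl k≢0
at-peak [] 1<t []         pys (suc k) _   = at-< 1<t pys k
at-peak (_ ∷ xs) 1<t (px ∷ pxs) pys zero    _   = px
at-peak (_ ∷ xs) 1<t (px ∷ pxs) pys (suc k) k≢  = at-peak xs 1<t pxs pys k (k≢ ∘ cong suc)

lt : ∀ {a b} {_ : Bool.T (a <ᵇ b)} → a < b
lt {a} {b} {p} = ℕ.<ᵇ⇒< a b p

allLt : ∀ {t xs} {p : True (All.all? (ℕ._<? t) xs)} → All (_< t) xs
allLt {p = p} = toWitness p

-- `xs` gives the times of all rim positions but the last, whose time 1 is the default value of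
-- `at`; hence `m = suc (length xs)`.
listSchedule : ∀ T xs → let m = suc (length xs) in
  3 < T → All (_< T) xs → at xs 0 ≡ 1 → at xs 1 ≡ 1 →
  ∣ tabulate {n = m} (λ i → at xs (toℕ i) ≡ᵇ 1) ∣ ≡ ⌈ m /2⌉ →
  (∀ n → Rule (at xs) n) → Schedule m T
listSchedule T xs 3<T xs<T e₀ e₁ count rule = record
  { τ = at xs ; rule = rule ; τ<T = at-< (ℕ.<-trans lt 3<T) xs<T ; 3<T = 3<T
  ; τ₀ = e₀ ; τ₁ = e₁ ; τ-end = λ n → at-end xs ∘ s≤s⁻¹ ; count = count }

schedule₅ : Schedule 5 4
schedule₅ = listSchedule 4 (1 ∷ 1 ∷ 3 ∷ 3 ∷ []) lt allLt refl refl refl λ where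
    0 → byPendant refl
    1 → byPendant refl
    2 → byPrevious 0 refl lt refl lt
    -- Positions 4 and 5 are both read past the end of the list: the last rim vertex and,
    -- cyclically, position 0.
    3 → byNext lt refl lt
    (suc (suc (suc (suc n)))) → byPendant refl

schedule₆ : Schedule 6 5
schedule₆ = listSchedule 5 (1 ∷ 1 ∷ 3 ∷ 4 ∷ 3 ∷ []) lt allLt refl refl refl λ where
    0 → byPendant refl
    1 → byPendant refl
    2 → byPrevious 0 refl lt refl lt
    3 → byHub lt (at-peak (1 ∷ 1 ∷ 3 ∷ []) lt allLt allLt)
    4 → byNext lt refl lt
    (suc (suc (suc (suc (suc n))))) → byPendant refl

schedule₇ : Schedule 7 5
schedule₇ = listSchedule 5 (1 ∷ 1 ∷ 3 ∷ 4 ∷ 1 ∷ 3 ∷ []) lt allLt refl refl refl λ where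
    0 → byPendant refl
    1 → byPendant refl
    2 → byPrevious 0 refl lt refl lt
    -- Position 4 can force position 3 only after position 5 turns blue at time 3; hence the time 4.
    3 → byNext lt refl lt
    4 → byPendant refl
    5 → byNext lt refl lt
    (suc (suc (suc (suc (suc (suc n)))))) → byPendant refl

schedule₈ : Schedule 8 6
schedule₈ = listSchedule 6 (1 ∷ 1 ∷ 3 ∷ 5 ∷ 4 ∷ 1 ∷ 3 ∷ []) lt allLt refl refl refl λ where
    0 → byPendant refl
    1 → byPendant refl
    2 → byPrevious 0 refl lt refl lt
    -- The hub has to wait for position 4, of time 4, before it forces position 3.
    3 → byHub lt (at-peak (1 ∷ 1 ∷ 3 ∷ []) lt allLt allLt)
    4 → byNext lt refl lt
    5 → byPendant refl
    6 → byNext lt refl lt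
    (suc (suc (suc (suc (suc (suc (suc n))))))) → byPendant refl

-- Residues modulo 4 and the theorem.

Bounds : ℕ → ℕ → Set
Bounds r T = (r ≡ 0 → T ≤ 6) × (r ≡ 1 → T ≤ 4) × (r ≡ 2 ⊎ r ≡ 3 → T ≤ 5)

-- Prefixing a block keeps `T` and the residue modulo 4, so four base cases suffice.
schedule : ∀ n → ∃[ T ] Schedule (5 + n) T × Bounds ((5 + n) % 4) T
schedule 0 = 4 , schedule₅ , (λ ()) , (λ _ → ℕ.≤-refl) , λ { (inj₁ ()) ; (inj₂ ()) }
schedule 1 = 5 , schedule₆ , (λ ()) , (λ ()) , λ _ → ℕ.≤-refl
schedule 2 = 5 , schedule₇ , (λ ()) , (λ ()) , λ _ → ℕ.≤-refl
schedule 3 = 6 , schedule₈ , (λ _ → ℕ.≤-refl) , (λ ()) , λ { (inj₁ ()) ; (inj₂ ()) }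
schedule (suc (suc (suc (suc n)))) with T , s , bounds ← schedule n =
  T , extend (s≤s (s≤s z≤n)) s , subst (λ r → Bounds r T) (sym shift) bounds
  where
  shift : (9 + n) % 4 ≡ (5 + n) % 4
  shift = trans (cong (_% 4) (ℕ.+-comm 4 (5 + n))) ([m+n]%n≡m%n (5 + n) 4)

theorem3p5 : (m : ℕ) → 5 ≤ m →
    IsZeroForcingNumber (helm m) ⌈ m /2⌉ ×
    (∃[ p ] IsPropagationTime (helm m) p ×
    (m % 4 ≡ 0 → p ≤ 6) ×
    (m % 4 ≡ 1 → p ≤ 4) ×
    (m % 4 ≡ 2 ⊎ m % 4 ≡ 3 → p ≤ 5))
theorem3p5 m 5≤m
  with n , refl ← ℕ.m≤n⇒∃[o]m+o≡n 5≤m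
  with T , s , ≤6 , ≤4 , ≤5 ← schedule n =
  isZ , p , p-is-pt , ℕ.≤-trans p≤T ∘ ≤6 , ℕ.≤-trans p≤T ∘ ≤4 , ℕ.≤-trans p≤T ∘ ≤5
  where
  isZ : IsZeroForcingNumber (helm m) ⌈ m /2⌉
  isZ = (initial s , allBlue⇒isZeroForcingSet (helm m) (allBlue s (s≤s z≤n)) , ∣initial∣ s) ,
        λ { j (B , zfs , refl) → helm-lower B zfs }
  pt = propagationTime (helm m) isZ (initial s , ∣initial∣ s , allBlue s (s≤s z≤n))
  p = proj₁ pt
  p-is-pt = proj₁ (proj₂ pt)
  p≤T = proj₂ (proj₂ pt)
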